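{- For every integer $r\ge 2$ there exists a finite family $\mathcal{F}$ of $r$-graphs such that $$\operatorname{sat}(\mathcal{F},n)=\begin{cases} O(n) & \text{if } n \text{ is even},\\ \Omega\left(n^{r-1}\right) & \text{if } n \text{ is odd}.\end{cases}$$
   Context: An $r$-graph $H$ is a pair $(V(H),E(H))$ where $V(H)$ is a finite set of vertices and the edge set $E(H)$ is a collection of $r$-element subsets of $V(H)$. Write $|H|=|V(H)|$ and $e(H)=|E(H)|$. Containment of one $r$-graph in another as a subgraph means containing a (not necessarily induced) copy of it. For a family $\mathcal{F}$ of $r$-graphs, an $r$-graph $H$ is called $\mathcal{F}$-saturated if it does not contain any graph in $\mathcal{F}$ as a subgraph, but adding any extra edge (that is, any $r$-element subset of $V(H)$ not in $E(H)$) to $H$ creates a copy of some graph $F\in\mathcal{F}$ as a subgraph. The saturation number is $$\operatorname{sat}(\mathcal{F},n)=\min\{e(H): |H|=n \text{ and } H \text{ is } \mathcal{F}\text{ -saturated}\}.$$ The notations $O(\cdot)$ and $\Omega(\cdot)$ are asymptotic as $n\to\infty$ along the indicated values of $n$ (even, respectively odd), with $r$ and $\mathcal{F}$ fixed. -}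

module Defs where

open import Data.Fin using (Fin)
open import Data.Fin.Properties using (any?; _≟_)
open import Data.Fin.Subset using (Subset; ∣_∣)
open import Data.Fin.Subset.Properties using (_∈?_)
open import Data.List using (List; _∷_; length)
open import Data.List.Membership.Propositional using (_∈_; _∉_)
open import Data.List.Relation.Unary.All.Properties using (¬Any⇒All¬)
open import Data.List.Relation.Unary.All using (All; _∷_)
open import Data.List.Relation.Unary.AllPairs using (_∷_)
open import Data.List.Relation.Unary.Any using (Any)
open import Data.List.Relation.Unary.Unique.Propositional using (Unique)
open import Data.Nat using (ℕ; _*_; _≤_)
open import Data.Product using (∃; ∃-syntax; _×_; _,_)
open import Data.Vec using (tabulate)
open import Function.Definitions using (Injective)
open import Relation.Binary.PropositionalEquality using (_≡_)
open import Relation.Nullary using (¬_; does)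
open import Relation.Nullary.Decidable using (_×-dec_)

-- An r-graph on the vertex set Fin n.  The edge set is a duplicate-free list,
-- so that its length is its cardinality.
record RGraph (r n : ℕ) : Set where
  field
    edges   : List (Subset n)
    uniform : All (λ e → ∣ e ∣ ≡ r) edges
    unique  : Unique edges

open RGraph public

size : ∀ {r n} → RGraph r n → ℕ
size H = length (edges H)

addEdge : ∀ {r n} (H : RGraph r n) (e : Subset n) →
          ∣ e ∣ ≡ r → e ∉ edges H → RGraph r n
addEdge H e ∣e∣≡r e∉H = record
  { edges   = e ∷ edges H
  ; uniform = ∣e∣≡r ∷ uniform H
  ; unique  = ¬Any⇒All¬ (edges H) e∉H ∷ unique H
  }

image : ∀ {k n} → (Fin k → Fin n) → Subset k → Subset n
image f p = tabulate λ j → does (any? λ i → (i ∈? p) ×-dec (f i ≟ j))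

-- H contains a (not necessarily induced) copy of F.
_⊑_ : ∀ {r k n} → RGraph r k → RGraph r n → Set
_⊑_ {k = k} {n} F H =
  ∃[ f ] Injective {A = Fin k} {B = Fin n} _≡_ _≡_ f ×
         All (λ e → image f e ∈ edges H) (edges F)

-- Finite families; the members may have different numbers of vertices.
Family : ℕ → Set
Family r = List (∃ (RGraph r))

Saturated : ∀ {r n} → Family r → RGraph r n → Set
Saturated {r} ℱ H =
  All (λ (_ , F) → ¬ (F ⊑ H)) ℱ ×
  (∀ e (∣e∣≡r : ∣ e ∣ ≡ r) (e∉H : e ∉ edges H) →
    Any (λ (_ , F) → F ⊑ addEdge H e ∣e∣≡r e∉H) ℱ)

-- m = sat(ℱ, n).  This is a relation because a family with an edgeless member
-- has no saturated graphs on n vertices for large n, leaving no minimum.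
IsSat : ∀ {r} → Family r → ℕ → ℕ → Set
IsSat {r} ℱ n m =
  (∃[ H ] Saturated {r} {n} ℱ H × size H ≡ m) ×
  (∀ (H : RGraph r n) → Saturated ℱ H → m ≤ size H)

-- f(n) = O(g(n)) as n → ∞ along the n satisfying P.  For ℕ-valued functions
-- a real constant can be rounded up to a natural number.
BigO : (ℕ → Set) → (ℕ → ℕ) → (ℕ → ℕ) → Set
BigO P f g = ∃[ C ] ∃[ N ] (∀ n → N ≤ n → P n → f n ≤ C * g n)

BigΩ : (ℕ → Set) → (ℕ → ℕ) → (ℕ → ℕ) → Set
BigΩ P f g = BigO P g f

{-# OPTIONS --safe #-}
module Submission where

-- Write r = suc t, and call a set of s = 2r vertices all of whose r-subsets are
-- edges a clique.  A sunflower is a set of cliques any two of which meet in one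
-- and the same kernel, of size w = 2r - 2.  Each clique then contributes two
-- vertices outside the kernel, so that a sunflower covers an even number of
-- vertices: this is where the parity of n enters.
--
-- A graph is bad if it is crossed (some edge e has each of its vertices in a
-- clique that does not contain e) or skew (there are cliques C, D, X with C and
-- D distinct and the intersection of all three not of size w).  The family
-- consists of the bad graphs in which every vertex lies in a clique and which
-- have at most (3 + r) s vertices.  Badness passes to every graph containing a
-- bad one (bad-image), and is witnessed inside the union of at most 3 + r
-- cliques (bad⇒copy), so a graph avoids the family exactly when it is not bad.
--
-- Even n.  The sunflower of all (n - w) / 2 cliques on a given kernel has O(n)
-- edges, its cliques are exactly the ones it was built from, and it is not bad.
-- Every vertex lies in one of these cliques, and a new edge lies in none of
-- them, so adding it makes the graph crossed.  Hence it is saturated.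
--
-- Odd n.  In a saturated graph H with n > s, if all vertices were covered by
-- cliques then, H not being skew, these cliques would form a sunflower and n
-- would be even (covered⇒even).  So some vertex v is in no clique.  Let e be an
-- r-set through v that is not an edge.  Adding e creates a member of the family,
-- which must use e, hence v; in it v lies in a clique, which must contain e as
-- v is in no clique of H.  As r < s, this clique without v still has an r-set
-- containing e - v, and this is an edge of H (shadow).  Therefore every
-- (r - 1)-set avoiding v lies in an edge of H, and counting (r - 1)-tuples gives
-- n ^ (r - 1) ≤ size H * (r + 1) ^ (r - 1).
--
-- The saturation number exists for every family all of whose members have edges:
-- a graph avoiding the family with the most edges is saturated, and there are
-- finitely many graphs on n vertices, for which saturation is decidable.

open import Defs
open import Data.Nat using (ℕ; _≤_; _∸_; _^_)
open import Data.Nat.Divisibility using (_∣_; _∤_)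
open import Data.Product using (Σ-syntax; _×_)

open import Data.Bool.Properties using () renaming (_≟_ to _≟ᵇ_)
open import Data.Empty using (⊥-elim)
open import Data.Fin using (Fin; zero; suc; fromℕ<; combine; finToFun; funToFin)
import Data.Fin.Properties as Fin
open import Data.Fin.Subset
open import Data.Fin.Subset.Properties
open import Data.List using (List; []; _∷_; length; _++_; map; filter; deduplicate; upTo; concatMap)
import Data.List as List
open import Data.List.Extrema.Nat
  using (argmin; argmax; f[argmin]≤f[xs]; f[xs]≤f[argmax]; argmin-all; argmax-all)
import Data.List.Membership.DecPropositional as DecMembership
open import Data.List.Membership.Propositional
  using (lose; find) renaming (_∈_ to _∈ₗ_; _∉_ to _∉ₗ_)
open import Data.List.Membership.Propositional.Properties
  using (∈-++⁺ˡ; ∈-++⁺ʳ; ∈-map⁺; ∈-filter⁺; ∈-filter⁻; ∈-deduplicate⁺; ∈-deduplicate⁻;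
         ∈-lookup; ∈-upTo⁺; ∈-concatMap⁺)
open import Data.List.Relation.Unary.All as All using (All; []; _∷_)
import Data.List.Relation.Unary.All.Properties as All
open import Data.List.Relation.Unary.AllPairs using ([]; _∷_)
open import Data.List.Relation.Unary.Any as Any using (Any; here; there)
open import Data.List.Relation.Unary.Any.Properties using (lookup-index)
open import Data.List.Relation.Unary.Unique.Propositional using (Unique)
import Data.List.Relation.Unary.Unique.DecPropositional.Properties as UniqueDec
open import Data.Nat using (zero; suc; _<_; _+_; _*_; z≤n; s≤s; s≤s⁻¹)
open import Data.Nat.Divisibility using (divides; _∣0; ∣-refl; ∣m∣n⇒∣m+n; n∣m*n)
open import Data.Nat.Induction using (<-wellFounded)
import Data.Nat.Properties as ℕ
open import Data.Product using (∃; ∃-syntax; _,_; proj₁; proj₂)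
open import Data.Sum using (_⊎_; inj₁; inj₂; [_,_]′)
open import Data.Vec using ([]; _∷_; lookup; tabulate; here; there)
open import Data.Vec.Properties using (≡-dec; lookup∘tabulate; lookup⇒[]=; []=⇒lookup)
open import Function using (_∘_; id; case_of_)
open import Function.Definitions using (Injective)
open import Induction.WellFounded using (Acc; acc)
open import Relation.Binary.PropositionalEquality
open import Relation.Nullary
open import Relation.Nullary.Decidable
  using (dec-true; _×-dec_; _→-dec_; _⊎-dec_; ¬?; map′; decidable-stable)
open import Relation.Unary using (Decidable)

-- Images, preimages and cardinalities of subsets

Inj : ∀ {k n} → (Fin k → Fin n) → Set
Inj {k} {n} f = Injective {A = Fin k} {B = Fin n} _≡_ _≡_ f

∈-comprehension⁺ : ∀ {n} {P : Fin n → Set} (P? : Decidable P) {j} →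
                   P j → j ∈ tabulate (λ i → does (P? i))
∈-comprehension⁺ P? {j} pj =
  lookup⇒[]= j _ (trans (lookup∘tabulate _ j) (dec-true (P? j) pj))

∈-comprehension⁻ : ∀ {n} {P : Fin n → Set} (P? : Decidable P) {j} →
                   j ∈ tabulate (λ i → does (P? i)) → P j
∈-comprehension⁻ P? {j} j∈
  with P? j | trans (sym (lookup∘tabulate (λ i → does (P? i)) j)) ([]=⇒lookup j∈)
... | yes pj | _ = pj
... | no  _  | ()

-- By definition, image f p is the set of the points j satisfying this.
hit? : ∀ {k n} (f : Fin k → Fin n) p → Decidable (λ j → ∃[ i ] i ∈ p × f i ≡ j)
hit? f p j = Fin.any? λ i → (i ∈? p) ×-dec (f i Fin.≟ j)

∈-image⁺ : ∀ {k n} (f : Fin k → Fin n) {p i} → i ∈ p → f i ∈ image f p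
∈-image⁺ f {p} {i} i∈p = ∈-comprehension⁺ (hit? f p) (i , i∈p , refl)

∈-image⁻ : ∀ {k n} (f : Fin k → Fin n) {p j} →
           j ∈ image f p → ∃[ i ] i ∈ p × f i ≡ j
∈-image⁻ f {p} = ∈-comprehension⁻ (hit? f p)

preimage : ∀ {k n} → (Fin k → Fin n) → Subset n → Subset k
preimage f q = tabulate λ i → does (f i ∈? q)

∈-preimage⁺ : ∀ {k n} (f : Fin k → Fin n) {q i} → f i ∈ q → i ∈ preimage f q
∈-preimage⁺ f {q} = ∈-comprehension⁺ (λ i → f i ∈? q)

∈-preimage⁻ : ∀ {k n} (f : Fin k → Fin n) {q i} → i ∈ preimage f q → f i ∈ q
∈-preimage⁻ f {q} = ∈-comprehension⁻ (λ i → f i ∈? q)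

⊆-image : ∀ {k n} {f : Fin k → Fin n} {p q} →
          p ⊆ preimage f q → image f p ⊆ q
⊆-image {f = f} {q = q} h y∈ with ∈-image⁻ f y∈
... | i , i∈p , refl = ∈-preimage⁻ f {q} (h i∈p)

-- An enumeration of the set p without repetition by Fin m; it
-- exists exactly when m is the cardinality of p.
Listing : ∀ {n} → ℕ → Subset n → Set
Listing {n} m p =
  ∃[ f ] Inj {m} {n} f × (∀ i → f i ∈ p) × (∀ {x} → x ∈ p → ∃[ i ] f i ≡ x)

listing : ∀ {n} (p : Subset n) → Listing ∣ p ∣ p
listing [] = (λ ()) , (λ { {()} }) , (λ ()) , λ ()
listing (outside ∷ p) with listing p
... | f , f-inj , f∈ , f-onto =
  suc ∘ f , f-inj ∘ Fin.suc-injective , there ∘ f∈ ,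
  λ { (there x∈p) → let i , eq = f-onto x∈p in i , cong suc eq }
listing (inside ∷ p) with listing p
... | f , f-inj , f∈ , f-onto = g , g-inj , g∈ , g-onto
  where
  g : Fin (suc ∣ p ∣) → Fin _
  g zero    = zero
  g (suc i) = suc (f i)
  g-inj : Inj g
  g-inj {zero}  {zero}  _  = refl
  g-inj {suc i} {suc j} eq = cong suc (f-inj (Fin.suc-injective eq))
  g∈ : ∀ i → g i ∈ inside ∷ p
  g∈ zero    = here
  g∈ (suc i) = there (f∈ i)
  g-onto : ∀ {x} → x ∈ inside ∷ p → ∃[ i ] g i ≡ x
  g-onto here        = zero , refl
  g-onto (there x∈p) = let i , eq = f-onto x∈p in suc i , cong suc eq

-- Cardinalities compare along a relation that is total on p and under which no
-- two elements have a common partner.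
∣∣-≤ : ∀ {k n} {p : Subset k} {q : Subset n} (R : Fin k → Fin n → Set) →
       (∀ {x} → x ∈ p → ∃[ y ] y ∈ q × R x y) →
       (∀ {x x′ y} → R x y → R x′ y → x ≡ x′) → ∣ p ∣ ≤ ∣ q ∣
∣∣-≤ {p = p} {q} R total inj with listing p | listing q
... | f , f-inj , f∈ , _ | g , _ , _ , g-onto = Fin.injective⇒≤ h-inj
  where
  h : ∀ i → ∃[ j ] R (f i) (g j)
  h i with total (f∈ i)
  ... | y , y∈q , rxy with g-onto y∈q
  ... | j , refl = j , rxy
  h-inj : Inj (proj₁ ∘ h)
  h-inj {i} {i′} eq =
    f-inj (inj (proj₂ (h i)) (subst (R (f i′) ∘ g) (sym eq) (proj₂ (h i′))))

∣image∣ : ∀ {k n} {f : Fin k → Fin n} → Inj f → ∀ p → ∣ image f p ∣ ≡ ∣ p ∣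
∣image∣ {f = f} f-inj p = ℕ.≤-antisym
  (∣∣-≤ (λ y x → f x ≡ y) (∈-image⁻ f) (λ { refl refl → refl }))
  (∣∣-≤ (λ x y → f x ≡ y) (λ {x} x∈p → f x , ∈-image⁺ f x∈p , refl)
        (λ eq eq′ → f-inj (trans eq (sym eq′))))

-- The set q lies in the range of f.
Within : ∀ {k n} → (Fin k → Fin n) → Subset n → Set
Within f q = ∀ {x} → x ∈ q → ∃[ i ] f i ≡ x

image-preimage : ∀ {k n} {f : Fin k → Fin n} {q} →
                 Within f q → image f (preimage f q) ≡ q
image-preimage {f = f} {q} onto = ⊆-antisym (⊆-image {f = f} {preimage f q} id) λ x∈q →
  lem x∈q (onto x∈q)
  where
  lem : ∀ {x} → x ∈ q → ∃[ i ] f i ≡ x → x ∈ image f (preimage f q)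
  lem x∈q (i , refl) = ∈-image⁺ f (∈-preimage⁺ f x∈q)

∣preimage∣ : ∀ {k n} {f : Fin k → Fin n} {q} →
             Inj f → Within f q → ∣ preimage f q ∣ ≡ ∣ q ∣
∣preimage∣ {f = f} {q} f-inj onto =
  trans (sym (∣image∣ f-inj (preimage f q))) (cong ∣_∣ (image-preimage {q = q} onto))

image-∩ : ∀ {k n} {f : Fin k → Fin n} → Inj f →
          ∀ p q → image f (p ∩ q) ≡ image f p ∩ image f q
image-∩ {f = f} f-inj p q = ⊆-antisym
  (λ y∈ → let i , i∈ , eq = ∈-image⁻ f y∈
              i∈p , i∈q = x∈p∩q⁻ p q i∈
          in x∈p∩q⁺ (subst (_∈ _) eq (∈-image⁺ f i∈p) , subst (_∈ _) eq (∈-image⁺ f i∈q)))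
  (λ y∈ → let y∈p , y∈q = x∈p∩q⁻ (image f p) (image f q) y∈
              i , i∈ , eq = ∈-image⁻ f y∈p
              j , j∈ , eq′ = ∈-image⁻ f y∈q
          in subst (_∈ _) eq (∈-image⁺ f
               (x∈p∩q⁺ (i∈ , subst (_∈ q) (f-inj (trans eq′ (sym eq))) j∈))))

preimage-∩ : ∀ {k n} (f : Fin k → Fin n) p q →
             preimage f (p ∩ q) ≡ preimage f p ∩ preimage f q
preimage-∩ f p q = ⊆-antisym
  (λ x∈ → let a , b = x∈p∩q⁻ p q (∈-preimage⁻ f {p ∩ q} x∈)
          in x∈p∩q⁺ (∈-preimage⁺ f a , ∈-preimage⁺ f b))
  (λ x∈ → let a , b = x∈p∩q⁻ (preimage f p) (preimage f q) x∈
          in ∈-preimage⁺ f (x∈p∩q⁺ (∈-preimage⁻ f {p} a , ∈-preimage⁻ f {q} b)))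

image-cancel-⊆ : ∀ {k n} {f : Fin k → Fin n} → Inj f → ∀ {p q} →
                 image f p ⊆ image f q → p ⊆ q
image-cancel-⊆ {f = f} f-inj {q = q} h x∈p with ∈-image⁻ f (h (∈-image⁺ f x∈p))
... | i , i∈q , eq = subst (_∈ q) (f-inj eq) i∈q

∣∪∣-≤ : ∀ {n} (p q : Subset n) → ∣ p ∪ q ∣ ≤ ∣ p ∣ + ∣ q ∣
∣∪∣-≤ [] [] = z≤n
∣∪∣-≤ (outside ∷ p) (outside ∷ q) = ∣∪∣-≤ p q
∣∪∣-≤ (outside ∷ p) (inside  ∷ q) =
  ℕ.≤-trans (s≤s (∣∪∣-≤ p q)) (ℕ.≤-reflexive (sym (ℕ.+-suc ∣ p ∣ ∣ q ∣)))
∣∪∣-≤ (inside  ∷ p) (outside ∷ q) = s≤s (∣∪∣-≤ p q)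
∣∪∣-≤ (inside  ∷ p) (inside  ∷ q) =
  s≤s (ℕ.≤-trans (∣∪∣-≤ p q) (ℕ.+-monoʳ-≤ ∣ p ∣ (ℕ.n≤1+n ∣ q ∣)))

∣∩∣+∣─∣ : ∀ {n} (p q : Subset n) → ∣ p ∩ q ∣ + ∣ p ─ q ∣ ≡ ∣ p ∣
∣∩∣+∣─∣ [] [] = refl
∣∩∣+∣─∣ (outside ∷ p) (outside ∷ q) = ∣∩∣+∣─∣ p q
∣∩∣+∣─∣ (outside ∷ p) (inside  ∷ q) = ∣∩∣+∣─∣ p q
∣∩∣+∣─∣ (inside  ∷ p) (outside ∷ q) =
  trans (ℕ.+-suc ∣ p ∩ q ∣ ∣ p ─ q ∣) (cong suc (∣∩∣+∣─∣ p q))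
∣∩∣+∣─∣ (inside  ∷ p) (inside  ∷ q) = cong suc (∣∩∣+∣─∣ p q)

x∈p─q⁻ : ∀ {n} {p q : Subset n} {x} → x ∈ p ─ q → x ∈ p × x ∉ q
x∈p─q⁻ {p = p} {q} x∈ = p─q⊆p p q x∈ , go p q x∈
  where
  go : ∀ {n} (p q : Subset n) {x} → x ∈ p ─ q → x ∉ q
  go (_ ∷ p) (outside ∷ q) (there x∈) (there x∈q) = go p q x∈ x∈q
  go (_ ∷ p) (inside  ∷ q) (there x∈) (there x∈q) = go p q x∈ x∈q

⊆∧≥⇒≡ : ∀ {n} {p q : Subset n} → p ⊆ q → ∣ q ∣ ≤ ∣ p ∣ → p ≡ q
⊆∧≥⇒≡ {p = p} {q} p⊆q q≤p = ⊆-antisym p⊆q q⊆p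
  where
  q⊆p : q ⊆ p
  q⊆p {x} x∈q with x ∈? p
  ... | yes x∈p = x∈p
  ... | no  x∉p = contradiction q≤p (ℕ.<⇒≱ (p⊂q⇒∣p∣<∣q∣ (p⊆q , x , x∈q , x∉p)))

∣∣<⇒∃∉ : ∀ {n} {p q : Subset n} → ∣ p ∣ < ∣ q ∣ → ∃[ x ] x ∈ q × x ∉ p
∣∣<⇒∃∉ {p = p} {q} p<q with nonempty? (q ─ p)
... | yes (x , x∈) = x , x∈p─q⁻ {p = q} {p} x∈
... | no  empty    = contradiction p<q (ℕ.≤⇒≯ (p⊆q⇒∣p∣≤∣q∣ q⊆p))
  where
  q⊆p : q ⊆ p
  q⊆p {x} x∈q with x ∈? p
  ... | yes x∈p = x∈p
  ... | no  x∉p = ⊥-elim (empty (x , x∈p∧x∉q⇒x∈p─q x∈q x∉p))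

-- Between nested sets there is one of each intermediate size.
interpolate : ∀ {n} {p q : Subset n} {m} → p ⊆ q → ∣ p ∣ ≤ m → m ≤ ∣ q ∣ →
              ∃[ e ] p ⊆ e × e ⊆ q × ∣ e ∣ ≡ m
interpolate {p = []} {[]} {zero} p⊆q _ _ = [] , id , id , refl
interpolate {p = outside ∷ p} {outside ∷ q} p⊆q p≤m m≤q
  with interpolate (drop-∷-⊆ p⊆q) p≤m m≤q
... | e , p⊆e , e⊆q , eq = outside ∷ e , s⊆s p⊆e , s⊆s e⊆q , eq
interpolate {p = outside ∷ p} {inside ∷ q} {m} p⊆q p≤m m≤q with m ℕ.≤? ∣ q ∣
... | no m≰q = inside ∷ q , p⊆q , id , ℕ.≤-antisym (ℕ.≰⇒> m≰q) m≤q
... | yes m≤q′ with interpolate (drop-∷-⊆ p⊆q) p≤m m≤q′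
...   | e , p⊆e , e⊆q , eq = outside ∷ e , s⊆s p⊆e , out⊆ e⊆q , eq
interpolate {p = inside ∷ p} {outside ∷ q} p⊆q _ _ with p⊆q here
... | ()
interpolate {p = inside ∷ p} {inside ∷ q} {suc m} p⊆q (s≤s p≤m) (s≤s m≤q)
  with interpolate (drop-∷-⊆ p⊆q) p≤m m≤q
... | e , p⊆e , e⊆q , eq = inside ∷ e , s⊆s p⊆e , s⊆s e⊆q , cong suc eq

-- The union of an indexed family of sets.
⋃ᶠ : ∀ {m n} → (Fin m → Subset n) → Subset n
⋃ᶠ C = ⋃ (List.tabulate C)

⊆-⋃ᶠ : ∀ {m n} (C : Fin m → Subset n) i → C i ⊆ ⋃ᶠ C
⊆-⋃ᶠ C zero    x∈ = x∈p∪q⁺ (inj₁ x∈)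
⊆-⋃ᶠ C (suc i) x∈ = x∈p∪q⁺ (inj₂ (⊆-⋃ᶠ (C ∘ suc) i x∈))

∈-⋃ᶠ⁻ : ∀ {m n} (C : Fin m → Subset n) {x} → x ∈ ⋃ᶠ C → ∃[ i ] x ∈ C i
∈-⋃ᶠ⁻ {zero}  C x∈ = ⊥-elim (∉⊥ x∈)
∈-⋃ᶠ⁻ {suc m} C x∈ with x∈p∪q⁻ (C zero) _ x∈
... | inj₁ x∈C = zero , x∈C
... | inj₂ x∈′ = let i , x∈C = ∈-⋃ᶠ⁻ (C ∘ suc) x∈′ in suc i , x∈C

∣⋃ᶠ∣-≤ : ∀ {m n b} (C : Fin m → Subset n) → (∀ i → ∣ C i ∣ ≤ b) → ∣ ⋃ᶠ C ∣ ≤ m * b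
∣⋃ᶠ∣-≤ {zero}  {n} C _  = ℕ.≤-reflexive (∣⊥∣≡0 n)
∣⋃ᶠ∣-≤ {suc m} C ≤b = ℕ.≤-trans (∣∪∣-≤ (C zero) (⋃ᶠ (C ∘ suc)))
  (ℕ.+-mono-≤ (≤b zero) (∣⋃ᶠ∣-≤ (C ∘ suc) (≤b ∘ suc)))

funToFin-cong : ∀ {m n} {f g : Fin m → Fin n} → (∀ i → f i ≡ g i) → funToFin f ≡ funToFin g
funToFin-cong {zero}  f≗g = refl
funToFin-cong {suc m} f≗g = cong₂ combine (f≗g zero) (funToFin-cong (f≗g ∘ suc))

finToFun-injective : ∀ {m n} {a b : Fin (n ^ m)} →
                     (∀ i → finToFun {n} {m} a i ≡ finToFun b i) → a ≡ b
finToFun-injective {m} {n} {a} {b} same = trans (sym (Fin.funToFin-finToFin {m} {n} a))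
  (trans (funToFin-cong same) (Fin.funToFin-finToFin {m} {n} b))

listing-of : ∀ {m n} {p : Subset n} → ∣ p ∣ ≡ m → Listing m p
listing-of {p = p} refl = listing p

-- A set of size m containing m listed (not necessarily distinct) points.
enclose : ∀ {m n} (x : Fin m → Fin n) → m ≤ n → ∃[ e ] ∣ e ∣ ≡ m × (∀ i → x i ∈ e)
enclose {m} {n} x m≤n =
  let e , range⊆e , _ , ∣e∣≡m = interpolate {p = ⋃ᶠ points} {⊤} ⊆⊤
        (ℕ.≤-trans (∣⋃ᶠ∣-≤ points (λ i → ℕ.≤-reflexive (∣⁅x⁆∣≡1 (x i))))
                   (ℕ.≤-reflexive (ℕ.*-identityʳ m)))
        (ℕ.≤-trans m≤n (ℕ.≤-reflexive (sym (∣⊤∣≡n n))))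
  in e , ∣e∣≡m , λ i → range⊆e (⊆-⋃ᶠ points i (x∈⁅x⁆ (x i)))
  where
  points : Fin m → Subset n
  points i = ⁅ x i ⁆

-- If each of A distinct d-tuples has all its entries in one of N sets of size at
-- most m, then A ≤ N * m ^ d.  A tuple is encoded by the index of such a set and
-- the positions of the entries in an enumeration of it.
tuples-≤ : ∀ {N m n A d} (B : Fin N → Subset n) (x : Fin A → Fin d → Fin n) →
  (∀ j → ∣ B j ∣ ≤ m) → m ≤ n →
  (∀ {a b} → (∀ i → x a i ≡ x b i) → a ≡ b) →
  (∀ a → ∃[ j ] ∀ i → x a i ∈ B j) →
  A ≤ N * m ^ d
tuples-≤ {N} {m} {n} {A} {d} B x ≤m m≤n x-inj covered = Fin.injective⇒≤ {f = code} code-inj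
  where
  -- The set B j is enlarged to size exactly m, so that all share one length.
  enum : ∀ j → ∃[ f ] (∀ {y} → y ∈ B j → ∃[ i ] f i ≡ y)
  enum j with interpolate (⊆⊤ {p = B j}) (≤m j)
                (ℕ.≤-trans m≤n (ℕ.≤-reflexive (sym (∣⊤∣≡n n))))
  ... | e , B⊆e , _ , refl with listing e
  ... | f , _ , _ , f-onto = f , f-onto ∘ B⊆e
  block : Fin A → Fin N
  block a = proj₁ (covered a)
  g : Fin N → Fin m → Fin n
  g j = proj₁ (enum j)
  pos : ∀ a i → ∃[ y ] g (block a) y ≡ x a i
  pos a i = proj₂ (enum (block a)) (proj₂ (covered a) i)
  code : Fin A → Fin (N * m ^ d)
  code a = combine (block a) (funToFin (λ i → proj₁ (pos a i)))
  code-inj : Inj code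
  code-inj {a} {b} eq with Fin.combine-injective (block a) _ (block b) _ eq
  ... | same-block , same-pos = x-inj λ i → begin
    x a i                           ≡⟨ proj₂ (pos a i) ⟨
    g (block a) (proj₁ (pos a i))   ≡⟨ cong₂ g same-block (same i) ⟩
    g (block b) (proj₁ (pos b i))   ≡⟨ proj₂ (pos b i) ⟩
    x b i                           ∎
    where
    open ≡-Reasoning
    same : ∀ i → proj₁ (pos a i) ≡ proj₁ (pos b i)
    same i = trans (sym (Fin.finToFun-funToFin _ i))
      (trans (cong (λ c → finToFun c i) same-pos) (Fin.finToFun-funToFin _ i))

-- Doubling every point of Fin q: pair sends each of the two copies of a point to
-- it, and double takes both copies of every element.
pair : ∀ {q} → Fin (q * 2) → Fin q
pair {suc q} zero          = zero
pair {suc q} (suc zero)    = zero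
pair {suc q} (suc (suc x)) = suc (pair x)

double : ∀ {q} → Subset q → Subset (q * 2)
double []      = []
double (b ∷ p) = b ∷ b ∷ double p

∣double∣ : ∀ {q} (p : Subset q) → ∣ double p ∣ ≡ ∣ p ∣ * 2
∣double∣ []            = refl
∣double∣ (outside ∷ p) = ∣double∣ p
∣double∣ (inside  ∷ p) = cong (λ c → suc (suc c)) (∣double∣ p)

∈-double⁺ : ∀ {q} {p : Subset q} {x} → pair x ∈ p → x ∈ double p
∈-double⁺ {p = _ ∷ p} {zero}        here       = here
∈-double⁺ {p = _ ∷ p} {suc zero}    here       = there here
∈-double⁺ {p = _ ∷ p} {suc (suc x)} (there h)  = there (there (∈-double⁺ h))

∈-double⁻ : ∀ {q} {p : Subset q} {x} → x ∈ double p → pair x ∈ p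
∈-double⁻ {p = _ ∷ p} {zero}        here              = here
∈-double⁻ {p = _ ∷ p} {suc zero}    (there here)      = here
∈-double⁻ {p = _ ∷ p} {suc (suc x)} (there (there h)) = there (∈-double⁻ h)

-- Finite search over subsets, graphs and copies

_≟ₛ_ : ∀ {n} (p q : Subset n) → Dec (p ≡ q)
_≟ₛ_ = ≡-dec _≟ᵇ_

_∈ₗ?_ : ∀ {n} (e : Subset n) E → Dec (e ∈ₗ E)
_∈ₗ?_ = DecMembership._∈?_ _≟ₛ_

all-subsets? : ∀ {n} {P : Subset n → Set} → Decidable P → Dec (∀ p → P p)
all-subsets? P? = map′
  (λ none p → decidable-stable (P? p) (λ ¬Pp → none (p , ¬Pp)))
  (λ all (p , ¬Pp) → ¬Pp (all p))
  (¬? (anySubset? (¬? ∘ P?)))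

allSubsets : ∀ n → List (Subset n)
allSubsets zero    = [] ∷ []
allSubsets (suc n) =
  map (inside ∷_) (allSubsets n) ++ map (outside ∷_) (allSubsets n)

∈-allSubsets : ∀ {n} (p : Subset n) → p ∈ₗ allSubsets n
∈-allSubsets []            = here refl
∈-allSubsets (inside  ∷ p) = ∈-++⁺ˡ (∈-map⁺ (inside ∷_) (∈-allSubsets p))
∈-allSubsets (outside ∷ p) = ∈-++⁺ʳ _ (∈-map⁺ (outside ∷_) (∈-allSubsets p))

sublists : ∀ {A : Set} → List A → List (List A)
sublists []       = [] ∷ []
sublists (x ∷ xs) = map (x ∷_) (sublists xs) ++ sublists xs

filter∈sublists : ∀ {A : Set} {P : A → Set} (P? : Decidable P) xs →
                  filter P? xs ∈ₗ sublists xs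
filter∈sublists P? []       = here refl
filter∈sublists P? (x ∷ xs) with P? x
... | yes _ = ∈-++⁺ˡ (∈-map⁺ (x ∷_) (filter∈sublists P? xs))
... | no  _ = ∈-++⁺ʳ _ (filter∈sublists P? xs)

lookup-injective : ∀ {A : Set} {xs : List A} → Unique xs →
                   ∀ {i j} → List.lookup xs i ≡ List.lookup xs j → i ≡ j
lookup-injective (_ ∷ _)   {zero}  {zero}  _  = refl
lookup-injective (x∉ ∷ _)  {zero}  {suc j} eq = ⊥-elim (All.lookup x∉ (∈-lookup j) eq)
lookup-injective (x∉ ∷ _)  {suc i} {zero}  eq = ⊥-elim (All.lookup x∉ (∈-lookup i) (sym eq))
lookup-injective (_ ∷ xs!) {suc i} {suc j} eq = cong suc (lookup-injective xs! eq)

length-≤ : ∀ {A : Set} {xs ys : List A} → Unique xs →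
           (∀ {x} → x ∈ₗ xs → x ∈ₗ ys) → length xs ≤ length ys
length-≤ {xs = xs} {ys} xs! xs⊆ys = Fin.injective⇒≤ {f = Any.index ∘ pos} λ {i} {j} eq →
  lookup-injective xs! (begin
    List.lookup xs i                     ≡⟨ lookup-index (pos i) ⟩
    List.lookup ys (Any.index (pos i))   ≡⟨ cong (List.lookup ys) eq ⟩
    List.lookup ys (Any.index (pos j))   ≡⟨ lookup-index (pos j) ⟨
    List.lookup xs j                     ∎)
  where
  open ≡-Reasoning
  pos : ∀ i → List.lookup xs i ∈ₗ ys
  pos i = xs⊆ys (∈-lookup i)

-- The r-graph whose edges are the r-sets in a given list.
graphOn : ∀ {n} r → List (Subset n) → RGraph r n
graphOn r es = record
  { edges   = deduplicate _≟ₛ_ (filter (λ e → ∣ e ∣ ℕ.≟ r) es)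
  ; uniform = All.deduplicate⁺ _≟ₛ_ (All.all-filter (λ e → ∣ e ∣ ℕ.≟ r) es)
  ; unique  = UniqueDec.deduplicate-! _≟ₛ_ _
  }

-- Up to the order of the edges, all r-graphs on n vertices: see canonical below.
graphs : ∀ r n → List (RGraph r n)
graphs r n = map (graphOn r) (sublists (allSubsets n))

-- The r-graph whose edges are the r-sets satisfying P.
graphOf : ∀ r {n} {P : Subset n → Set} → Decidable P → RGraph r n
graphOf r {n} P? = graphOn r (filter P? (allSubsets n))

graphOf∈graphs : ∀ r {n} {P : Subset n → Set} (P? : Decidable P) →
                 graphOf r P? ∈ₗ graphs r n
graphOf∈graphs r {n} P? = ∈-map⁺ (graphOn r) (filter∈sublists P? (allSubsets n))

module _ {r n : ℕ} {P : Subset n → Set} (P? : Decidable P) where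

  ∈-graphOf⁺ : ∀ {e} → ∣ e ∣ ≡ r → P e → e ∈ₗ edges (graphOf r P?)
  ∈-graphOf⁺ {e} eq pe = ∈-deduplicate⁺ _≟ₛ_
    (∈-filter⁺ (λ e → ∣ e ∣ ℕ.≟ r) (∈-filter⁺ P? (∈-allSubsets e) pe) eq)

  ∈-graphOf⁻ : ∀ {e} → e ∈ₗ edges (graphOf r P?) → ∣ e ∣ ≡ r × P e
  ∈-graphOf⁻ e∈ =
    let es       = filter P? (allSubsets n)
        e∈′ , eq = ∈-filter⁻ (λ e → ∣ e ∣ ℕ.≟ r) {xs = es}
                     (∈-deduplicate⁻ _≟ₛ_ (filter (λ e → ∣ e ∣ ℕ.≟ r) es) e∈)
    in eq , proj₂ (∈-filter⁻ P? {xs = allSubsets n} e∈′)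

-- Containment of edge lists: F ⊑ H is by definition edges F ↪ edges H.
_↪_ : ∀ {k n} → List (Subset k) → List (Subset n) → Set
_↪_ {k} {n} E E′ = ∃[ f ] Inj {k} {n} f × All (λ e → image f e ∈ₗ E′) E

_⊆ₗ_ : ∀ {n} → List (Subset n) → List (Subset n) → Set
E ⊆ₗ E′ = ∀ {e} → e ∈ₗ E → e ∈ₗ E′

↪-mono : ∀ {k n} {E : List (Subset k)} {E′ E″ : List (Subset n)} →
         E′ ⊆ₗ E″ → E ↪ E′ → E ↪ E″
↪-mono sub (f , f-inj , h) = f , f-inj , All.map sub h

image-cong : ∀ {k n} {f g : Fin k → Fin n} → (∀ i → f i ≡ g i) →
             ∀ p → image f p ≡ image g p
image-cong {f = f} {g} f≗g p = ⊆-antisym (sub f g f≗g) (sub g f (sym ∘ f≗g))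
  where
  sub : ∀ f g → (∀ i → f i ≡ g i) → image f p ⊆ image g p
  sub f g f≗g y∈ = let i , i∈ , eq = ∈-image⁻ f y∈ in
    subst (_∈ image g p) (trans (sym (f≗g i)) eq) (∈-image⁺ g i∈)

-- Functions Fin k → Fin n are searched through their codes in Fin (n ^ k).
_↪?_ : ∀ {k n} (E : List (Subset k)) (E′ : List (Subset n)) → Dec (E ↪ E′)
_↪?_ {k} {n} E E′ = map′ (λ (c , h) → finToFun c , h) code
    (Fin.any? λ c → copy? (finToFun c))
  where
  Copy : (Fin k → Fin n) → Set
  Copy f = Inj f × All (λ e → image f e ∈ₗ E′) E
  inj? : ∀ f → Dec (Inj {k} {n} f)
  inj? f = map′ (λ h {i} {j} → h i j) (λ h i j → h {i} {j})
    (Fin.all? λ i → Fin.all? λ j → (f i Fin.≟ f j) →-dec (i Fin.≟ j))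
  copy? : ∀ f → Dec (Copy f)
  copy? f = inj? f ×-dec All.all? (λ e → image f e ∈ₗ? E′) E
  code : E ↪ E′ → ∃[ c ] Copy (finToFun c)
  code (f , f-inj , h) = funToFin f ,
    (λ {i} {j} eq → f-inj (trans (sym (≗f i)) (trans eq (≗f j)))) ,
    All.map (λ {e} → subst (_∈ₗ E′) (image-cong (sym ∘ ≗f) e)) h
    where
    ≗f : ∀ i → finToFun (funToFin f) i ≡ f i
    ≗f = Fin.finToFun-funToFin f

-- Existence of the saturation number

module Saturation {r : ℕ} (ℱ : Family r)
  (edged : All (λ (_ , F) → ∃[ e ] e ∈ₗ edges F) ℱ) where

  -- H contains no member of the family.
  Free : ∀ {n} → RGraph r n → Set
  Free H = All (λ (_ , F) → ¬ (F ⊑ H)) ℱ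

  free? : ∀ {n} → Decidable (Free {n})
  free? H = All.all? (λ (_ , F) → ¬? (edges F ↪? edges H)) ℱ

  saturated? : ∀ {n} → Decidable (Saturated {r} {n} ℱ)
  saturated? H = free? H ×-dec all-subsets? λ e → maximal? e
    where
    maximal? : ∀ e → Dec (∀ (∣e∣≡r : ∣ e ∣ ≡ r) (e∉H : e ∉ₗ edges H) →
                          Any (λ (_ , F) → F ⊑ addEdge H e ∣e∣≡r e∉H) ℱ)
    maximal? e = (∣ e ∣ ℕ.≟ r) →-dec (¬? (e ∈ₗ? edges H) →-dec
      Any.any? (λ (_ , F) → edges F ↪? (e ∷ edges H)) ℱ)

  Free-resp : ∀ {n} {H H′ : RGraph r n} → edges H ⊆ₗ edges H′ → Free H′ → Free H
  Free-resp sub = All.map (λ ¬F⊑H′ F⊑H → ¬F⊑H′ (↪-mono sub F⊑H))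

  Saturated-resp : ∀ {n} {H H′ : RGraph r n} →
    edges H ⊆ₗ edges H′ → edges H′ ⊆ₗ edges H → Saturated ℱ H → Saturated ℱ H′
  Saturated-resp {H = H} {H′} sub sup (free , maximal) =
    Free-resp {H = H′} {H} sup free , λ e ∣e∣≡r e∉H′ →
      Any.map (↪-mono λ { (here eq) → here eq ; (there e∈) → there (sub e∈) })
              (maximal e ∣e∣≡r (e∉H′ ∘ sub))

  -- The representative of H in graphs r n: it has the same edges as H, possibly in
  -- another order.
  module _ {n : ℕ} (H : RGraph r n) where
    canonical : RGraph r n
    canonical = graphOf r (_∈ₗ? edges H)

    canonical⊆ : edges canonical ⊆ₗ edges H
    canonical⊆ e∈ = proj₂ (∈-graphOf⁻ (_∈ₗ? edges H) e∈)

    ⊆canonical : edges H ⊆ₗ edges canonical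
    ⊆canonical e∈ = ∈-graphOf⁺ (_∈ₗ? edges H) (All.lookup (uniform H) e∈) e∈

    size-canonical : size canonical ≡ size H
    size-canonical = ℕ.≤-antisym (length-≤ (unique canonical) canonical⊆)
                                 (length-≤ (unique H) ⊆canonical)

  module _ (n : ℕ) where

    empty : RGraph r n
    empty = record { edges = [] ; uniform = [] ; unique = [] }

    empty-free : Free empty
    empty-free = All.map (λ { (e , e∈F) (f , _ , h) → case All.lookup h e∈F of λ () }) edged

    -- A graph avoiding the family with the most edges; it is saturated.
    largest : RGraph r n
    largest = argmax size empty (filter free? (graphs r n))

    largest-free : Free largest
    largest-free = argmax-all size {P = Free} empty-free (All.all-filter free? (graphs r n))

    largest-max : ∀ H → Free H → size H ≤ size largest
    largest-max H free = ℕ.≤-trans (ℕ.≤-reflexive (sym (size-canonical H)))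
      (All.lookup (f[xs]≤f[argmax] {f = size} empty (filter free? (graphs r n)))
        (∈-filter⁺ free? (graphOf∈graphs r (_∈ₗ? edges H))
          (Free-resp {H = canonical H} {H} (canonical⊆ H) free)))

    largest-saturated : Saturated ℱ largest
    largest-saturated = largest-free , λ e ∣e∣≡r e∉ →
      decidable-stable (Any.any? (λ (_ , F) → edges F ↪? (e ∷ edges largest)) ℱ)
        λ none → ℕ.<-irrefl refl
          (largest-max (addEdge largest e ∣e∣≡r e∉) (All.¬Any⇒All¬ ℱ none))

    -- A saturated graph with the fewest edges.
    smallest : RGraph r n
    smallest = argmin size largest (filter saturated? (graphs r n))

    smallest-saturated : Saturated ℱ smallest
    smallest-saturated = argmin-all size {P = Saturated ℱ} largest-saturated
      (All.all-filter saturated? (graphs r n))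

    smallest-min : ∀ H → Saturated ℱ H → size smallest ≤ size H
    smallest-min H sat = ℕ.≤-trans
      (All.lookup (f[argmin]≤f[xs] {f = size} largest (filter saturated? (graphs r n)))
        (∈-filter⁺ saturated? (graphOf∈graphs r (_∈ₗ? edges H))
          (Saturated-resp {H = H} {canonical H} (⊆canonical H) (canonical⊆ H) sat)))
      (ℕ.≤-reflexive (size-canonical H))

    satNumber : ℕ
    satNumber = size smallest

    satNumber-IsSat : IsSat ℱ n satNumber
    satNumber-IsSat = (smallest , smallest-saturated , refl) , smallest-min

-- Cliques and bad graphs

-- The uniformity is r = suc t.
module Construction (t : ℕ) (1≤t : 1 ≤ t) where

  -- Sizes of an edge, of a clique and of the kernel of a sunflower; s = 2 + w.
  r s w : ℕ
  r = suc t
  s = r * 2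
  w = t * 2

  r<s : r < s
  r<s = s≤s (s≤s (ℕ.m≤m*n t 2))

  r≤s : r ≤ s
  r≤s = ℕ.<⇒≤ r<s

  -- A set of s vertices all of whose r-subsets belong to the edge list E.  This and
  -- the notions below depend on the edge list alone, which is how they apply to a
  -- graph H and to the list e ∷ edges H of a graph with an added edge.
  Clique : ∀ {n} → List (Subset n) → Subset n → Set
  Clique E C = ∣ C ∣ ≡ s × (∀ e → ∣ e ∣ ≡ r → e ⊆ C → e ∈ₗ E)

  -- The vertex v lies in a clique.
  Covered : ∀ {n} → List (Subset n) → Fin n → Set
  Covered E v = ∃[ C ] Clique E C × v ∈ C

  -- Some edge has each of its vertices in a clique that does not contain it.
  Crossed : ∀ {n} → List (Subset n) → Set
  Crossed E = ∃[ e ] ∣ e ∣ ≡ r × e ∈ₗ E ×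
    (∀ v → v ∈ e → ∃[ C ] Clique E C × v ∈ C × e ⊈ C)

  -- Two distinct cliques do not meet in exactly w vertices (the case that X is D),
  -- or a third clique does not contain their intersection.
  Skew : ∀ {n} → List (Subset n) → Set
  Skew E = ∃[ C ] ∃[ D ] ∃[ X ] Clique E C × Clique E D × Clique E X ×
    C ≢ D × ∣ C ∩ D ∩ X ∣ ≢ w

  -- The configurations excluded by the forbidden family.
  Bad : ∀ {n} → List (Subset n) → Set
  Bad E = Crossed E ⊎ Skew E

  module _ {n : ℕ} (E : List (Subset n)) where

    clique? : Decidable (Clique E)
    clique? C = (∣ C ∣ ℕ.≟ s) ×-dec
      all-subsets? λ e → (∣ e ∣ ℕ.≟ r) →-dec ((e ⊆? C) →-dec (e ∈ₗ? E))

    covered? : Decidable (Covered E)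
    covered? v = anySubset? λ C → clique? C ×-dec (v ∈? C)

    bad? : Dec (Bad E)
    bad? =
      (anySubset? λ e → (∣ e ∣ ℕ.≟ r) ×-dec ((e ∈ₗ? E) ×-dec
        Fin.all? λ v → (v ∈? e) →-dec
          anySubset? λ C → clique? C ×-dec ((v ∈? C) ×-dec ¬? (e ⊆? C))))
      ⊎-dec
      (anySubset? λ C → anySubset? λ D → anySubset? λ X →
        clique? C ×-dec (clique? D ×-dec (clique? X ×-dec
        (¬? (C ≟ₛ D) ×-dec ¬? (∣ C ∩ D ∩ X ∣ ℕ.≟ w)))))

  -- Badness is inherited by every graph containing a bad one.
  module _ {k n : ℕ} {E : List (Subset k)} {E′ : List (Subset n)} (E↪E′ : E ↪ E′) where

    private
      f = proj₁ E↪E′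
      f-inj : Inj f
      f-inj = proj₁ (proj₂ E↪E′)
      copy = proj₂ (proj₂ E↪E′)

    clique-image : ∀ {C} → Clique E C → Clique E′ (image f C)
    clique-image {C} (∣C∣≡s , full) = trans (∣image∣ f-inj C) ∣C∣≡s , λ e ∣e∣≡r e⊆ →
      let onto : Within f e
          onto x∈e = let i , _ , eq = ∈-image⁻ f {C} (e⊆ x∈e) in i , eq
          pre⊆C : preimage f e ⊆ C
          pre⊆C i∈ = image-cancel-⊆ f-inj {preimage f e}
                       (λ x∈ → e⊆ (subst (_ ∈_) (image-preimage {q = e} onto) x∈)) i∈
      in subst (_∈ₗ E′) (image-preimage onto)
           (All.lookup copy (full (preimage f e) (trans (∣preimage∣ f-inj onto) ∣e∣≡r) pre⊆C))

    bad-image : Bad E → Bad E′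
    bad-image (inj₁ (e , ∣e∣≡r , e∈E , cross)) =
      inj₁ (image f e , trans (∣image∣ f-inj e) ∣e∣≡r , All.lookup copy e∈E , cross′)
      where
      cross′ : ∀ v → v ∈ image f e → ∃[ C ] Clique E′ C × v ∈ C × image f e ⊈ C
      cross′ v v∈ with ∈-image⁻ f {e} v∈
      ... | i , i∈e , refl with cross i i∈e
      ... | C , C-clique , i∈C , e⊈C =
        image f C , clique-image C-clique , ∈-image⁺ f i∈C ,
        λ sub → e⊈C (image-cancel-⊆ f-inj {e} {C} sub)
    bad-image (inj₂ (C , D , X , cC , cD , cX , C≢D , meet≢w)) =
      inj₂ (image f C , image f D , image f X ,
        clique-image cC , clique-image cD , clique-image cX ,
        (λ eq → C≢D (⊆-antisym
          (image-cancel-⊆ f-inj {C} {D} (⊆-reflexive eq))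
          (image-cancel-⊆ f-inj {D} {C} (⊆-reflexive (sym eq))))) ,
        λ eq → meet≢w (begin
          ∣ C ∩ D ∩ X ∣                             ≡⟨ ∣image∣ f-inj (C ∩ D ∩ X) ⟨
          ∣ image f (C ∩ D ∩ X) ∣                   ≡⟨ cong ∣_∣ (image-∩ f-inj C (D ∩ X)) ⟩
          ∣ image f C ∩ image f (D ∩ X) ∣           ≡⟨ cong (λ p → ∣ image f C ∩ p ∣)
                                                         (image-∩ f-inj D X) ⟩
          ∣ image f C ∩ image f D ∩ image f X ∣     ≡⟨ eq ⟩
          w                                         ∎))
      where open ≡-Reasoning

  -- The forbidden family

  -- A bound on the number of vertices of the members: the union of 3 + r cliques
  -- has at most this size.
  K : ℕ
  K = (3 + r) * s

  -- Besides being bad, a member has all its vertices in cliques.  This is what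
  -- puts the uncovered vertex into a clique in shadow below.
  Member : ∃ (RGraph r) → Set
  Member (_ , F) = (∀ v → Covered (edges F) v) × Bad (edges F)

  member? : Decidable Member
  member? (_ , F) = Fin.all? (covered? (edges F)) ×-dec bad? (edges F)

  -- The family is used only through the two lemmas on its members.
  abstract
    family : Family r
    family = filter member? (concatMap (λ k → map (k ,_) (graphs r k)) (upTo (suc K)))

    family-members : All Member family
    family-members =
      All.all-filter member? (concatMap (λ k → map (k ,_) (graphs r k)) (upTo (suc K)))

    ∈-family : ∀ {k} {G : RGraph r k} → k ≤ K → G ∈ₗ graphs r k → Member (k , G) →
               (k , G) ∈ₗ family
    ∈-family {k} k≤K G∈ = ∈-filter⁺ member? (∈-concatMap⁺ (λ k → map (k ,_) (graphs r k))
      {xs = upTo (suc K)} (lose (∈-upTo⁺ (s≤s k≤K)) (∈-map⁺ (k ,_) G∈)))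

  clique-edge : ∀ {n} {E : List (Subset n)} {C} → Clique E C → ∃[ e ] e ∈ₗ E
  clique-edge {n} {C = C} (∣C∣≡s , full) =
    let e , _ , e⊆C , ∣e∣≡r = interpolate {p = ⊥} {C} {r} (⊆-min C)
          (ℕ.≤-trans (ℕ.≤-reflexive (∣⊥∣≡0 n)) z≤n)
          (ℕ.≤-trans r≤s (ℕ.≤-reflexive (sym ∣C∣≡s)))
    in e , full e ∣e∣≡r e⊆C

  family-edged : All (λ (_ , F) → ∃[ e ] e ∈ₗ edges F) family
  family-edged = All.map (λ { (_ , bad) → edge bad }) family-members
    where
    edge : ∀ {n} {E : List (Subset n)} → Bad E → ∃[ e ] e ∈ₗ E
    edge (inj₁ (e , _ , e∈E , _))     = e , e∈E
    edge (inj₂ (_ , _ , _ , cC , _)) = clique-edge cC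

  ¬bad⇒free : ∀ {n} {H : RGraph r n} → ¬ Bad (edges H) → All (λ (_ , F) → ¬ (F ⊑ H)) family
  ¬bad⇒free ¬bad = All.map (λ { (_ , bad) F⊑H → ¬bad (bad-image F⊑H bad) }) family-members

  -- The restriction G of a graph to the union U of at most 3 + r of its cliques,
  -- relabelled by an enumeration of U.  It belongs to the family as soon as it is
  -- bad.
  module Localise {n m : ℕ} (E : List (Subset n)) (m≤ : m ≤ 3 + r) (C : Fin m → Subset n)
    (cliques : ∀ i → Clique E (C i)) where

    U : Subset n
    U = ⋃ᶠ C

    k : ℕ
    k = ∣ U ∣

    k≤K : k ≤ K
    k≤K = ℕ.≤-trans (∣⋃ᶠ∣-≤ C (λ i → ℕ.≤-reflexive (proj₁ (cliques i)))) (ℕ.*-monoˡ-≤ s m≤)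

    ι : Fin k → Fin n
    ι = proj₁ (listing U)

    ι-inj : Inj ι
    ι-inj = proj₁ (proj₂ (listing U))

    ι∈U : ∀ i → ι i ∈ U
    ι∈U = proj₁ (proj₂ (proj₂ (listing U)))

    within : ∀ {q} → q ⊆ U → Within ι q
    within q⊆U x∈q = proj₂ (proj₂ (proj₂ (listing U))) (q⊆U x∈q)

    pull? : Decidable (λ e → image ι e ∈ₗ E)
    pull? e = image ι e ∈ₗ? E

    G : RGraph r k
    G = graphOf r pull?

    G↪E : edges G ↪ E
    G↪E = ι , ι-inj , All.tabulate (λ e∈ → proj₂ (∈-graphOf⁻ pull? e∈))

    -- Restriction of sets of vertices to U.
    pull : Subset n → Subset k
    pull = preimage ι

    edge-pull : ∀ {e} → ∣ e ∣ ≡ r → e ⊆ U → e ∈ₗ E → ∣ pull e ∣ ≡ r × pull e ∈ₗ edges G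
    edge-pull ∣e∣≡r e⊆U e∈E = ∣pe∣≡r , ∈-graphOf⁺ pull? ∣pe∣≡r
      (subst (_∈ₗ E) (sym (image-preimage (within e⊆U))) e∈E)
      where
      ∣pe∣≡r = trans (∣preimage∣ ι-inj (within e⊆U)) ∣e∣≡r

    clique-pull : ∀ i → Clique (edges G) (pull (C i))
    clique-pull i with cliques i
    ... | ∣C∣≡s , full = trans (∣preimage∣ ι-inj (within (⊆-⋃ᶠ C i))) ∣C∣≡s ,
      λ e ∣e∣≡r e⊆ → ∈-graphOf⁺ pull? ∣e∣≡r
        (full (image ι e) (trans (∣image∣ ι-inj e) ∣e∣≡r) (⊆-image {f = ι} {e} {C i} e⊆))

    pull-cancel-⊆ : ∀ {p q} → p ⊆ U → pull p ⊆ pull q → p ⊆ q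
    pull-cancel-⊆ {p} {q} p⊆U sub x∈p with within p⊆U x∈p
    ... | i , refl = ∈-preimage⁻ ι {q} (sub (∈-preimage⁺ ι {p} x∈p))

    G-covered : ∀ v → Covered (edges G) v
    G-covered v with ∈-⋃ᶠ⁻ C (ι∈U v)
    ... | i , ιv∈C = pull (C i) , clique-pull i , ∈-preimage⁺ ι ιv∈C

    copy : Bad (edges G) → Any (λ (_ , F) → edges F ↪ E) family
    copy bad = lose (∈-family k≤K (graphOf∈graphs r pull?) (G-covered , bad)) G↪E

  -- For a crossed graph the cliques through the r vertices of the crossed edge
  -- suffice, for a skew graph the three cliques witnessing this.
  bad⇒copy : ∀ {n} {E : List (Subset n)} → Bad E → Any (λ (_ , F) → edges F ↪ E) family
  bad⇒copy {n} {E} (inj₁ (e , ∣e∣≡r , e∈E , cross)) with listing e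
  ... | f , _ , f∈e , f-onto = copy (inj₁ (pull e ,
      proj₁ (edge-pull ∣e∣≡r e⊆U e∈E) , proj₂ (edge-pull ∣e∣≡r e⊆U e∈E) , cross′))
    where
    witness : ∀ i → ∃[ C ] Clique E C × f i ∈ C × e ⊈ C
    witness i = cross (f i) (f∈e i)
    open Localise E (ℕ.≤-trans (ℕ.≤-reflexive ∣e∣≡r) (ℕ.m≤n+m r 3))
      (proj₁ ∘ witness) (proj₁ ∘ proj₂ ∘ witness)
    e⊆U : e ⊆ U
    e⊆U x∈e with f-onto x∈e
    ... | i , refl = ⊆-⋃ᶠ (proj₁ ∘ witness) i (proj₁ (proj₂ (proj₂ (witness i))))
    cross′ : ∀ v → v ∈ pull e → ∃[ C ] Clique (edges G) C × v ∈ C × pull e ⊈ C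
    cross′ v v∈ with f-onto (∈-preimage⁻ ι {e} v∈)
    ... | i , eq with witness i | clique-pull i
    ... | C , _ , fi∈C , e⊈C | pull-clique = pull C , pull-clique ,
      ∈-preimage⁺ ι {C} (subst (_∈ C) eq fi∈C) , λ sub → e⊈C (pull-cancel-⊆ {e} {C} e⊆U sub)
  bad⇒copy {n} {E} (inj₂ (C , D , X , cC , cD , cX , C≢D , meet≢w)) =
    copy (inj₂ (pull C , pull D , pull X ,
      clique-pull zero , clique-pull (suc zero) , clique-pull (suc (suc zero)) ,
      (λ eq → C≢D (⊆-antisym
        (pull-cancel-⊆ {C} {D} C⊆U (⊆-reflexive eq))
        (pull-cancel-⊆ {D} {C} (⊆-⋃ᶠ three (suc zero)) (⊆-reflexive (sym eq))))) ,
      λ eq → meet≢w (begin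
        ∣ C ∩ D ∩ X ∣                 ≡⟨ ∣preimage∣ ι-inj (within (λ x∈ → C⊆U (p∩q⊆p C _ x∈))) ⟨
        ∣ pull (C ∩ D ∩ X) ∣          ≡⟨ cong ∣_∣ (preimage-∩ ι C (D ∩ X)) ⟩
        ∣ pull C ∩ pull (D ∩ X) ∣     ≡⟨ cong (λ p → ∣ pull C ∩ p ∣) (preimage-∩ ι D X) ⟩
        ∣ pull C ∩ pull D ∩ pull X ∣  ≡⟨ eq ⟩
        w                             ∎)))
    where
    open ≡-Reasoning
    three : Fin 3 → Subset n
    three zero             = C
    three (suc zero)       = D
    three (suc (suc zero)) = X
    three-cliques : ∀ i → Clique E (three i)
    three-cliques zero             = cC
    three-cliques (suc zero)       = cD
    three-cliques (suc (suc zero)) = cX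
    open Localise E (ℕ.m≤m+n 3 r) three three-cliques
    C⊆U : C ⊆ U
    C⊆U = ⊆-⋃ᶠ three zero

  -- Graphs of odd order

  module _ {n : ℕ} {E : List (Subset n)} (¬bad : ¬ Bad E) (s<n : s < n) where

    private
      v₀ : Fin n
      v₀ = fromℕ< (ℕ.≤-trans (s≤s z≤n) s<n)

    covered⇒even : (∀ v → Covered E v) → 2 ∣ n
    covered⇒even covered = subst (2 ∣_) n-eq (∣m∣n⇒∣m+n (n∣m*n t) rest-even)
      where
      C₀ = proj₁ (covered v₀)
      clique₀ = proj₁ (proj₂ (covered v₀))
      outsider : ∃[ v ] v ∈ ⊤ × v ∉ C₀
      outsider = ∣∣<⇒∃∉ {p = C₀} {⊤} (ℕ.≤-trans (s≤s (ℕ.≤-reflexive (proj₁ clique₀)))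
        (ℕ.≤-trans s<n (ℕ.≤-reflexive (sym (∣⊤∣≡n n)))))
      v₁ = proj₁ outsider
      C₁ = proj₁ (covered v₁)
      clique₁ = proj₁ (proj₂ (covered v₁))
      C₀≢C₁ : C₀ ≢ C₁
      C₀≢C₁ eq = proj₂ (proj₂ outsider) (subst (v₁ ∈_) (sym eq) (proj₂ (proj₂ (covered v₁))))

      meet : ∀ {C D X} → Clique E C → Clique E D → Clique E X → C ≢ D → ∣ C ∩ D ∩ X ∣ ≡ w
      meet {C} {D} {X} cC cD cX C≢D = decidable-stable (∣ C ∩ D ∩ X ∣ ℕ.≟ w)
        λ ≢w → ¬bad (inj₂ (C , D , X , cC , cD , cX , C≢D , ≢w))

      -- The kernel.  Every clique X contains it: skewness is excluded for C₀, C₁, X.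
      W : Subset n
      W = C₀ ∩ C₁

      ∣W∣≡w : ∣ W ∣ ≡ w
      ∣W∣≡w = trans (cong (λ p → ∣ C₀ ∩ p ∣) (sym (∩-idem C₁))) (meet clique₀ clique₁ clique₁ C₀≢C₁)

      W⊆ : ∀ {X} → Clique E X → W ⊆ X
      W⊆ {X} cX x∈W = p∩q⊆q C₁ X (p∩q⊆q C₀ (C₁ ∩ X) (subst (_ ∈_) (sym same) x∈W))
        where
        sub : C₀ ∩ C₁ ∩ X ⊆ W
        sub x∈ = let a , b = x∈p∩q⁻ C₀ (C₁ ∩ X) x∈ in x∈p∩q⁺ (a , p∩q⊆p C₁ X b)
        same : C₀ ∩ C₁ ∩ X ≡ W
        same = ⊆∧≥⇒≡ sub (ℕ.≤-reflexive (trans ∣W∣≡w (sym (meet clique₀ clique₁ cX C₀≢C₁))))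

      ∩⊆W : ∀ {C D} → Clique E C → Clique E D → C ≢ D → C ∩ D ⊆ W
      ∩⊆W {C} {D} cC cD C≢D = ⊆-reflexive (sym (⊆∧≥⇒≡
        (λ x∈ → x∈p∩q⁺ (W⊆ cC x∈ , W⊆ cD x∈))
        (ℕ.≤-reflexive (trans
          (trans (cong (λ p → ∣ C ∩ p ∣) (sym (∩-idem D))) (meet cC cD cD C≢D))
          (sym ∣W∣≡w)))))

      -- U is a union of petals, a petal being a clique without the kernel.  Such a
      -- set is even, as petals have two elements and can be removed one by one.
      Closed : Subset n → Set
      Closed U = (∀ {x} → x ∈ U → x ∉ W) ×
        (∀ {C x} → Clique E C → x ∈ C → x ∈ U → C ─ W ⊆ U)

      closed-even : ∀ U → Closed U → Acc _<_ ∣ U ∣ → 2 ∣ ∣ U ∣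
      closed-even U (U∌W , closed) (acc rec) with nonempty? U
      ... | no empty = subst (2 ∣_)
              (sym (trans (cong ∣_∣ (Empty-unique empty)) (∣⊥∣≡0 n))) (2 ∣0)
      ... | yes (x , x∈U) with covered x
      ... | C , cC , x∈C = subst (2 ∣_) (trans (cong (_+ ∣ U ─ C ∣) (sym two)) (∣∩∣+∣─∣ U C))
              (∣m∣n⇒∣m+n ∣-refl (closed-even (U ─ C) (U′∌W , closed′)
                (rec (p∩q≢∅⇒∣p─q∣<∣p∣ U C (x , x∈p∩q⁺ (x∈U , x∈C))))))
        where
        -- U ∩ C is the petal of C, since U is closed and misses W.
        two : ∣ U ∩ C ∣ ≡ 2
        two = ℕ.+-cancelˡ-≡ w _ _ (begin
          w + ∣ U ∩ C ∣        ≡⟨ cong₂ (λ a p → a + ∣ p ∣) (sym ∣C∩W∣≡w) U∩C≡ ⟩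
          ∣ C ∩ W ∣ + ∣ C ─ W ∣ ≡⟨ ∣∩∣+∣─∣ C W ⟩
          ∣ C ∣                ≡⟨ proj₁ cC ⟩
          2 + w                ≡⟨ ℕ.+-comm 2 w ⟩
          w + 2                ∎)
          where
          open ≡-Reasoning
          ∣C∩W∣≡w : ∣ C ∩ W ∣ ≡ w
          ∣C∩W∣≡w = trans (cong ∣_∣ (⊆-antisym (p∩q⊆q C W)
            (λ x∈W → x∈p∩q⁺ (W⊆ cC x∈W , x∈W)))) ∣W∣≡w
          U∩C≡ : U ∩ C ≡ C ─ W
          U∩C≡ = ⊆-antisym
            (λ y∈ → let y∈U , y∈C = x∈p∩q⁻ U C y∈ in x∈p∧x∉q⇒x∈p─q y∈C (U∌W y∈U))
            (λ y∈ → x∈p∩q⁺ (closed cC x∈C x∈U y∈ , p─q⊆p C W y∈))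
        U′∌W : ∀ {x} → x ∈ U ─ C → x ∉ W
        U′∌W x∈ = U∌W (p─q⊆p U C x∈)
        closed′ : ∀ {D y} → Clique E D → y ∈ D → y ∈ U ─ C → D ─ W ⊆ U ─ C
        closed′ {D} {y} cD y∈D y∈ {z} z∈ with x∈p─q⁻ {p = U} {C} y∈ | x∈p─q⁻ {p = D} {W} z∈
        ... | y∈U , y∉C | z∈D , z∉W = x∈p∧x∉q⇒x∈p─q (closed cD y∈D y∈U z∈)
          λ z∈C → z∉W (∩⊆W cC cD (λ { refl → y∉C y∈D }) (x∈p∩q⁺ (z∈C , z∈D)))

      rest-even : 2 ∣ ∣ ⊤ ─ W ∣
      rest-even = closed-even (⊤ ─ W)
        ((λ x∈ → proj₂ (x∈p─q⁻ {p = ⊤} {W} x∈)) ,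
         λ {C} cC x∈C x∈ y∈ → x∈p∧x∉q⇒x∈p─q ∈⊤ (proj₂ (x∈p─q⁻ {p = C} {W} y∈)))
        (<-wellFounded _)

      n-eq : w + ∣ ⊤ ─ W ∣ ≡ n
      n-eq = trans (cong (_+ ∣ ⊤ ─ W ∣) (sym (trans (cong ∣_∣ (∩-identityˡ W)) ∣W∣≡w)))
        (trans (∣∩∣+∣─∣ ⊤ W) (∣⊤∣≡n n))

    odd⇒uncovered : 2 ∤ n → ∃[ v ] ¬ Covered E v
    odd⇒uncovered odd = Fin.¬∀⟶∃¬ n (Covered E) (covered? E) (odd ∘ covered⇒even)

  module _ {n : ℕ} {H : RGraph r n} (saturated : Saturated family H) where

    ¬bad : ¬ Bad (edges H)
    ¬bad bad = All.All¬⇒¬Any (proj₁ saturated) (bad⇒copy bad)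

    module _ {v : Fin n} (uncovered : ¬ Covered (edges H) v) where

      -- Every r-set e through v has e - v inside an edge.
      shadow : ∀ e → ∣ e ∣ ≡ r → v ∈ e → ∃[ q ] q ∈ₗ edges H × e - v ⊆ q
      shadow e ∣e∣≡r v∈e with e ∈ₗ? edges H
      ... | yes e∈H = e , e∈H , p─q⊆p e ⁅ v ⁆
      ... | no  e∉H = new (proj₂ saturated e ∣e∣≡r e∉H)
        where
        new : Any (λ (_ , F) → F ⊑ addEdge H e ∣e∣≡r e∉H) family →
              ∃[ q ] q ∈ₗ edges H × e - v ⊆ q
        new copies with find copies
        ... | (_ , F) , F∈ , F↪@(f , f-inj , copy)
          with Any.any? (λ p → image f p ≟ₛ e) (edges F)
        -- Every member that appears must use the new edge.
        ... | no none = ⊥-elim (All.lookup (proj₁ saturated) F∈ (f , f-inj ,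
                All.tabulate λ {p} p∈F → old (All.lookup copy p∈F)
                  λ eq → All.lookup (All.¬Any⇒All¬ (edges F) none) p∈F eq))
          where
          old : ∀ {p} → p ∈ₗ e ∷ edges H → p ≢ e → p ∈ₗ edges H
          old (here eq)  p≢e = ⊥-elim (p≢e eq)
          old (there p∈) _   = p∈
        ... | yes some with find some
        ... | p , p∈F , refl with ∈-image⁻ f {p} v∈e
        ... | i , i∈p , refl with proj₁ (All.lookup family-members F∈) i
        ... | C , C-clique , i∈C with image f p ⊆? image f C
        -- A clique through v without the new edge would be a clique of H.
        ... | no e⊈D = ⊥-elim (uncovered (image f C ,
                (proj₁ D-clique , λ q ∣q∣≡r q⊆D → old q⊆D (proj₂ D-clique q ∣q∣≡r q⊆D)) ,
                ∈-image⁺ f i∈C))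
          where
          D-clique : Clique (e ∷ edges H) (image f C)
          D-clique = clique-image F↪ C-clique
          old : ∀ {q} → q ⊆ image f C → q ∈ₗ e ∷ edges H → q ∈ₗ edges H
          old q⊆D (here refl) = ⊥-elim (e⊈D q⊆D)
          old q⊆D (there q∈H) = q∈H
        -- Inside the clique D, the set e - v extends to an edge other than e.
        ... | yes e⊆D = replacement
          where
          D = image f C
          D-clique : Clique (e ∷ edges H) D
          D-clique = clique-image F↪ C-clique
          r≤∣D-v∣ : r ≤ ∣ D - v ∣
          r≤∣D-v∣ = s≤s⁻¹ (begin
            suc r                            ≤⟨ r<s ⟩
            s                                ≡⟨ proj₁ D-clique ⟨
            ∣ D ∣                            ≡⟨ ∣∩∣+∣─∣ D ⁅ v ⁆ ⟨
            ∣ D ∩ ⁅ v ⁆ ∣ + ∣ D - v ∣        ≤⟨ ℕ.+-monoˡ-≤ ∣ D - v ∣ (ℕ.≤-trans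
                                                  (∣p∩q∣≤∣q∣ D ⁅ v ⁆) (ℕ.≤-reflexive (∣⁅x⁆∣≡1 v))) ⟩
            suc ∣ D - v ∣                    ∎)
            where open ℕ.≤-Reasoning
          e-v⊆D-v : e - v ⊆ D - v
          e-v⊆D-v x∈ = let x∈e , x∉v = x∈p─q⁻ {p = e} {⁅ v ⁆} x∈ in x∈p∧x∉q⇒x∈p─q (e⊆D x∈e) x∉v
          replacement : ∃[ q ] q ∈ₗ edges H × e - v ⊆ q
          replacement with interpolate e-v⊆D-v
            (ℕ.≤-trans (∣p─q∣≤∣p∣ e ⁅ v ⁆) (ℕ.≤-reflexive ∣e∣≡r)) r≤∣D-v∣
          ... | q , e-v⊆q , q⊆D-v , ∣q∣≡r
            with proj₂ D-clique q ∣q∣≡r (λ x∈ → p─q⊆p D ⁅ v ⁆ (q⊆D-v x∈))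
          ... | here refl = ⊥-elim (proj₂ (x∈p─q⁻ {p = D} {⁅ v ⁆} (q⊆D-v v∈e)) (x∈⁅x⁆ v))
          ... | there q∈H = q , q∈H , e-v⊆q

      -- Each t-tuple of vertices has all its entries in q ∪ ⁅ v ⁆ for some edge q.
      many-edges : suc r ≤ n → n ^ t ≤ size H * suc r ^ t
      many-edges r<n = tuples-≤ {d = t} B finToFun ∣B∣≤ r<n (finToFun-injective {t}) in-some
        where
        B : Fin (size H) → Subset n
        B j = List.lookup (edges H) j ∪ ⁅ v ⁆
        ∣B∣≤ : ∀ j → ∣ B j ∣ ≤ suc r
        ∣B∣≤ j = begin
          ∣ B j ∣                                     ≤⟨ ∣∪∣-≤ (List.lookup (edges H) j) ⁅ v ⁆ ⟩
          ∣ List.lookup (edges H) j ∣ + ∣ ⁅ v ⁆ ∣     ≡⟨ cong₂ _+_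
                                                           (All.lookup (uniform H) (∈-lookup j))
                                                           (∣⁅x⁆∣≡1 v) ⟩
          r + 1                                       ≡⟨ ℕ.+-comm r 1 ⟩
          suc r                                       ∎
          where open ℕ.≤-Reasoning
        in-some : ∀ a → ∃[ j ] ∀ i → finToFun {n} {t} a i ∈ B j
        in-some a with enclose v∷a (ℕ.<⇒≤ r<n)
          where
          v∷a : Fin r → Fin n
          v∷a zero    = v
          v∷a (suc i) = finToFun {n} {t} a i
        ... | e , ∣e∣≡r , v∷a∈e with shadow e ∣e∣≡r (v∷a∈e zero)
        ... | q , q∈H , e-v⊆q = Any.index q∈H , λ i → place (v∷a∈e (suc i))
          where
          place : ∀ {x} → x ∈ e → x ∈ B (Any.index q∈H)
          place {x} x∈e with x Fin.≟ v
          ... | yes refl = q⊆p∪q (List.lookup (edges H) (Any.index q∈H)) ⁅ v ⁆ (x∈⁅x⁆ v)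
          ... | no  x≢v  = p⊆p∪q ⁅ v ⁆
            (subst (x ∈_) (lookup-index q∈H) (e-v⊆q (x∈p∧x≢y⇒x∈p-y x∈e x≢v)))

  -- Graphs of even order: the sunflower on 2q vertices

  -- The vertices come in q pairs.  The kernel consists of t pairs, indexed by the
  -- set core, and each other pair completes it to a clique.
  module Even (q : ℕ) (r≤q : r ≤ q) where

    -- Which t pairs are chosen is irrelevant.
    abstract
      core-exists : ∃[ p ] ⊥ ⊆ p × p ⊆ ⊤ {q} × ∣ p ∣ ≡ t
      core-exists = interpolate ⊆⊤ (ℕ.≤-trans (ℕ.≤-reflexive (∣⊥∣≡0 q)) z≤n)
        (ℕ.≤-trans (ℕ.<⇒≤ r≤q) (ℕ.≤-reflexive (sym (∣⊤∣≡n q))))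

    core : Subset q
    core = proj₁ core-exists

    ∣core∣≡t : ∣ core ∣ ≡ t
    ∣core∣≡t = proj₂ (proj₂ (proj₂ core-exists))

    -- The kernel together with the j-th pair: a clique of the sunflower if j is not
    -- in core, and the kernel itself otherwise.
    leaf : Fin q → Subset (q * 2)
    leaf j = double (core ∪ ⁅ j ⁆)

    ∣core∪j∣≤r : ∀ j → ∣ core ∪ ⁅ j ⁆ ∣ ≤ r
    ∣core∪j∣≤r j = begin
      ∣ core ∪ ⁅ j ⁆ ∣         ≤⟨ ∣∪∣-≤ core ⁅ j ⁆ ⟩
      ∣ core ∣ + ∣ ⁅ j ⁆ ∣     ≡⟨ cong₂ _+_ ∣core∣≡t (∣⁅x⁆∣≡1 j) ⟩
      t + 1                    ≡⟨ ℕ.+-comm t 1 ⟩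
      r                        ∎
      where open ℕ.≤-Reasoning

    ∣leaf∣≤s : ∀ j → ∣ leaf j ∣ ≤ s
    ∣leaf∣≤s j = ℕ.≤-trans (ℕ.≤-reflexive (∣double∣ (core ∪ ⁅ j ⁆))) (ℕ.*-monoˡ-≤ 2 (∣core∪j∣≤r j))

    ∣leaf∣≡s : ∀ {j} → j ∉ core → ∣ leaf j ∣ ≡ s
    ∣leaf∣≡s {j} j∉core = trans (∣double∣ (core ∪ ⁅ j ⁆)) (cong (_* 2) (ℕ.≤-antisym (∣core∪j∣≤r j)
      (ℕ.≤-trans (s≤s (ℕ.≤-reflexive (sym ∣core∣≡t)))
        (p⊂q⇒∣p∣<∣q∣ (p⊆p∪q ⁅ j ⁆ , j , q⊆p∪q core ⁅ j ⁆ (x∈⁅x⁆ j) , j∉core)))))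

    ∣kernel∣≡w : ∣ double core ∣ ≡ w
    ∣kernel∣≡w = trans (∣double∣ core) (cong (_* 2) ∣core∣≡t)

    ∈-leaf⁺ : ∀ {x j} → pair x ∈ core ⊎ pair x ≡ j → x ∈ leaf j
    ∈-leaf⁺ {j = j} (inj₁ in-core) = ∈-double⁺ (p⊆p∪q ⁅ j ⁆ in-core)
    ∈-leaf⁺ {j = j} (inj₂ refl)    = ∈-double⁺ (q⊆p∪q core ⁅ j ⁆ (x∈⁅x⁆ j))

    ∈-leaf⁻ : ∀ {x j} → x ∈ leaf j → pair x ∈ core ⊎ pair x ≡ j
    ∈-leaf⁻ {j = j} x∈ with x∈p∪q⁻ core ⁅ j ⁆ (∈-double⁻ x∈)
    ... | inj₁ in-core = inj₁ in-core
    ... | inj₂ in-j    = inj₂ (x∈⁅y⁆⇒x≡y j in-j)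

    ∈-leaf-outside : ∀ {x j} → x ∈ leaf j → pair x ∉ core → pair x ≡ j
    ∈-leaf-outside x∈ x∉ with ∈-leaf⁻ x∈
    ... | inj₁ in-core = ⊥-elim (x∉ in-core)
    ... | inj₂ eq      = eq

    -- A pair outside the kernel, for a clique through the vertices of the kernel.
    spare : ∃[ j ] j ∈ ⊤ × j ∉ core
    spare = ∣∣<⇒∃∉ {p = core} {⊤} (ℕ.≤-trans (s≤s (ℕ.≤-reflexive ∣core∣≡t))
      (ℕ.≤-trans r≤q (ℕ.≤-reflexive (sym (∣⊤∣≡n q)))))

    in-leaf? : Decidable (λ e → ∃[ j ] e ⊆ leaf j)
    in-leaf? e = Fin.any? λ j → e ⊆? leaf j

    -- The r-sets contained in some leaf.
    abstract
      sunflower : RGraph r (q * 2)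
      sunflower = graphOf r in-leaf?

      ∈-sunflower⁺ : ∀ {e j} → ∣ e ∣ ≡ r → e ⊆ leaf j → e ∈ₗ edges sunflower
      ∈-sunflower⁺ {j = j} ∣e∣≡r e⊆ = ∈-graphOf⁺ in-leaf? ∣e∣≡r (j , e⊆)

      ∈-sunflower⁻ : ∀ {e} → e ∈ₗ edges sunflower → ∃[ j ] e ⊆ leaf j
      ∈-sunflower⁻ e∈ = proj₂ (∈-graphOf⁻ in-leaf? e∈)

    leaf-clique : ∀ {j} → j ∉ core → Clique (edges sunflower) (leaf j)
    leaf-clique {j} j∉core = ∣leaf∣≡s j∉core ,
      λ e ∣e∣≡r e⊆ → ∈-sunflower⁺ ∣e∣≡r e⊆

    -- A clique has more vertices than the kernel, so it has a vertex x outside; any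
    -- y in it shares an edge with x, and all edges through x lie in one leaf.
    clique-leaf : ∀ {C} → Clique (edges sunflower) C → ∃[ j ] j ∉ core × C ≡ leaf j
    clique-leaf {C} (∣C∣≡s , full)
      with ∣∣<⇒∃∉ {p = double core} {C} (ℕ.≤-trans (s≤s (ℕ.≤-reflexive ∣kernel∣≡w))
             (ℕ.≤-trans (ℕ.n≤1+n _) (ℕ.≤-reflexive (sym ∣C∣≡s))))
    ... | x , x∈C , x∉kernel = pair x , px∉core ,
        ⊆∧≥⇒≡ C⊆ (ℕ.≤-reflexive (trans (∣leaf∣≡s px∉core) (sym ∣C∣≡s)))
      where
      px∉core : pair x ∉ core
      px∉core = x∉kernel ∘ ∈-double⁺
      C⊆ : C ⊆ leaf (pair x)
      C⊆ {y} y∈C with interpolate {p = ⁅ x ⁆ ∪ ⁅ y ⁆} {C} {r}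
        (λ z∈ → [ (λ z∈x → subst (_∈ C) (sym (x∈⁅y⁆⇒x≡y x z∈x)) x∈C)
                , (λ z∈y → subst (_∈ C) (sym (x∈⁅y⁆⇒x≡y y z∈y)) y∈C) ]′
                (x∈p∪q⁻ ⁅ x ⁆ ⁅ y ⁆ z∈))
        (ℕ.≤-trans (∣∪∣-≤ ⁅ x ⁆ ⁅ y ⁆)
          (ℕ.≤-trans (ℕ.≤-reflexive (cong₂ _+_ (∣⁅x⁆∣≡1 x) (∣⁅x⁆∣≡1 y))) (s≤s 1≤t)))
        (ℕ.≤-trans r≤s (ℕ.≤-reflexive (sym ∣C∣≡s)))
      ... | e , xy⊆e , e⊆C , ∣e∣≡r with ∈-sunflower⁻ (full e ∣e∣≡r e⊆C)
      ... | j , e⊆leaf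
        with ∈-leaf-outside (e⊆leaf (xy⊆e (p⊆p∪q ⁅ y ⁆ (x∈⁅x⁆ x)))) px∉core
      ... | refl = e⊆leaf (xy⊆e (q⊆p∪q ⁅ x ⁆ ⁅ y ⁆ (x∈⁅x⁆ y)))

    in-kernel : ∀ {x i} → x ∈ double core → x ∈ leaf i
    in-kernel x∈ = ∈-leaf⁺ (inj₁ (∈-double⁻ x∈))

    -- Every edge has a vertex such that all leaves through this vertex contain the
    -- edge: any vertex outside the kernel if there is one, any vertex otherwise.
    pivot : ∀ {e j} → ∣ e ∣ ≡ r → e ⊆ leaf j →
            ∃[ x ] x ∈ e × (∀ {i} → x ∈ leaf i → e ⊆ leaf i)
    pivot {e} {j} ∣e∣≡r e⊆leaf = choose (nonempty? (e ─ double core))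
      where
      choose : Dec (Nonempty (e ─ double core)) →
               ∃[ x ] x ∈ e × (∀ {i} → x ∈ leaf i → e ⊆ leaf i)
      choose (yes (x , x∈)) = x , x∈e , λ x∈leaf →
        subst (λ i → e ⊆ leaf i)
          (trans (sym (∈-leaf-outside (e⊆leaf x∈e) px∉core)) (∈-leaf-outside x∈leaf px∉core))
          e⊆leaf
        where
        x∈e : x ∈ e
        x∈e = proj₁ (x∈p─q⁻ {p = e} {double core} x∈)
        px∉core : pair x ∉ core
        px∉core px∈ = proj₂ (x∈p─q⁻ {p = e} {double core} x∈) (∈-double⁺ px∈)
      choose (no empty) = proj₁ some , proj₁ (proj₂ some) , λ _ y∈e → inside-kernel y∈e
        where
        some : ∃[ x ] x ∈ e × x ∉ ⊥
        some = ∣∣<⇒∃∉ (ℕ.≤-trans (s≤s (ℕ.≤-reflexive (∣⊥∣≡0 (q * 2))))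
                 (ℕ.≤-trans (s≤s z≤n) (ℕ.≤-reflexive (sym ∣e∣≡r))))
        inside-kernel : ∀ {y i} → y ∈ e → y ∈ leaf i
        inside-kernel {y} y∈e with y ∈? double core
        ... | yes y∈ = in-kernel y∈
        ... | no  y∉ = ⊥-elim (empty (y , x∈p∧x∉q⇒x∈p─q y∈e y∉))

    ¬crossed : ¬ Crossed (edges sunflower)
    ¬crossed (e , ∣e∣≡r , e∈ , cross) =
      let _ , e⊆leaf          = ∈-sunflower⁻ e∈
          x , x∈e , through   = pivot ∣e∣≡r (λ {y} → e⊆leaf {y})
          C , cC , x∈C , e⊈C  = cross x x∈e
          i , _ , C≡leaf      = clique-leaf cC
      in e⊈C (subst (e ⊆_) (sym C≡leaf) (through (subst (x ∈_) C≡leaf x∈C)))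

    ¬skew : ¬ Skew (edges sunflower)
    ¬skew (C , D , X , cC , cD , cX , C≢D , ≢w)
      with clique-leaf cC | clique-leaf cD | clique-leaf cX
    ... | i , i∉ , refl | j , _ , refl | k , _ , refl =
      ≢w (trans (cong ∣_∣ (⊆-antisym sub sup)) ∣kernel∣≡w)
      where
      sub : leaf i ∩ leaf j ∩ leaf k ⊆ double core
      sub {x} x∈ with x∈p∩q⁻ (leaf i) (leaf j ∩ leaf k) x∈
      ... | x∈i , x∈jk with ∈-leaf⁻ x∈i | ∈-leaf⁻ (p∩q⊆p (leaf j) (leaf k) x∈jk)
      ... | inj₁ in-core | _            = ∈-double⁺ in-core
      ... | inj₂ _       | inj₁ in-core = ∈-double⁺ in-core
      ... | inj₂ refl    | inj₂ refl    = ⊥-elim (C≢D refl)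
      sup : double core ⊆ leaf i ∩ leaf j ∩ leaf k
      sup x∈ = x∈p∩q⁺ (all i , x∈p∩q⁺ (all j , all k))
        where
        all : ∀ j → _ ∈ leaf j
        all j = ∈-leaf⁺ (inj₁ (∈-double⁻ x∈))

    leaf-through : ∀ v → ∃[ j ] j ∉ core × v ∈ leaf j
    leaf-through v with pair v ∈? core
    ... | yes pv∈ = let j , _ , j∉ = spare in j , j∉ , ∈-leaf⁺ (inj₁ pv∈)
    ... | no  pv∉ = pair v , pv∉ , ∈-leaf⁺ (inj₂ refl)

    sunflower-saturated : Saturated family sunflower
    sunflower-saturated = ¬bad⇒free {H = sunflower} [ ¬crossed , ¬skew ]′ , λ e ∣e∣≡r e∉ →
      bad⇒copy (inj₁ (e , ∣e∣≡r , here refl , λ v v∈e →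
        let j , j∉ , v∈leaf = leaf-through v
            ∣leaf∣ , full = leaf-clique j∉
        in leaf j , (∣leaf∣ , λ d ∣d∣≡r d⊆ → there (full d ∣d∣≡r d⊆)) , v∈leaf ,
           λ e⊆leaf → e∉ (∈-sunflower⁺ ∣e∣≡r e⊆leaf)))

    -- Every edge is an r-tuple of elements of one of the q leaves.
    few-edges : size sunflower ≤ q * s ^ r
    few-edges = tuples-≤ {q} {s} {q * 2} {d = r} leaf (λ a → proj₁ (list a))
      ∣leaf∣≤s (ℕ.*-monoˡ-≤ 2 r≤q) list-inj in-some
      where
      edge : Fin (size sunflower) → Subset (q * 2)
      edge = List.lookup (edges sunflower)
      list : ∀ a → Listing r (edge a)
      list a = listing-of (All.lookup (uniform sunflower) (∈-lookup a))
      sub : ∀ {a b} → (∀ i → proj₁ (list a) i ≡ proj₁ (list b) i) → edge a ⊆ edge b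
      sub {a} {b} same x∈ with proj₂ (proj₂ (proj₂ (list a))) x∈
      ... | i , refl = subst (_∈ edge b) (sym (same i)) (proj₁ (proj₂ (proj₂ (list b))) i)
      list-inj : ∀ {a b} → (∀ i → proj₁ (list a) i ≡ proj₁ (list b) i) → a ≡ b
      list-inj {a} {b} same = lookup-injective (unique sunflower)
        (⊆-antisym (sub {a} {b} same) (sub {b} {a} (sym ∘ same)))
      in-some : ∀ a → ∃[ j ] ∀ i → proj₁ (list a) i ∈ leaf j
      in-some a with ∈-sunflower⁻ (∈-lookup {xs = edges sunflower} a)
      ... | j , e⊆leaf = j , λ i → e⊆leaf (proj₁ (proj₂ (proj₂ (list a))) i)

  -- The two asymptotic bounds

  open Saturation family family-edged public using (satNumber; satNumber-IsSat)
  open Saturation family family-edged using (smallest; smallest-saturated; smallest-min)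

  sat-even : ∀ n → s ≤ n → 2 ∣ n → satNumber n ≤ s ^ r * n
  sat-even _ s≤n (divides q refl) = begin
    satNumber (q * 2)     ≤⟨ smallest-min (q * 2) sunflower sunflower-saturated ⟩
    size sunflower        ≤⟨ few-edges ⟩
    q * s ^ r             ≡⟨ ℕ.*-comm q (s ^ r) ⟩
    s ^ r * q             ≤⟨ ℕ.*-monoʳ-≤ (s ^ r) (ℕ.m≤m*n q 2) ⟩
    s ^ r * (q * 2)       ∎
    where
    open ℕ.≤-Reasoning
    open Even q (ℕ.*-cancelʳ-≤ r q 2 s≤n)

  sat-odd : ∀ n → s < n → 2 ∤ n → n ^ t ≤ suc r ^ t * satNumber n
  sat-odd n s<n 2∤n = begin
    n ^ t                       ≤⟨ many-edges {H = smallest n} saturated uncovered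
                                     (ℕ.≤-trans r<s (ℕ.<⇒≤ s<n)) ⟩
    satNumber n * suc r ^ t     ≡⟨ ℕ.*-comm (satNumber n) (suc r ^ t) ⟩
    suc r ^ t * satNumber n     ∎
    where
    open ℕ.≤-Reasoning
    saturated = smallest-saturated n
    uncovered = proj₂ (odd⇒uncovered (¬bad {H = smallest n} saturated) s<n 2∤n)

theorem5 : (r : ℕ) → 2 ≤ r →
    Σ[ ℱ ∈ Family r ] Σ[ sat ∈ (ℕ → ℕ) ]
    (∀ n → IsSat ℱ n (sat n)) ×
    BigO (λ n → 2 ∣ n) sat (λ n → n) ×
    BigΩ (λ n → 2 ∤ n) sat (λ n → n ^ (r ∸ 1))
theorem5 (suc t) (s≤s 1≤t) =
  family , satNumber , satNumber-IsSat , (s ^ r , s , sat-even) , (suc r ^ t , suc s , sat-odd)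
  where open Construction t 1≤t
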